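{- Let $n\ge r\ge 2$ be integers and let $k$ be an integer with $k\le r!$. If $k>\left(1-\frac{1}{4(r-1)}\right)r!$, then $f(n,r,k)=n$.
   Context: An $r$-digraph $G$ consists of a finite vertex set $V(G)$ and an edge set $E(G)$ whose elements are ordered lists of $r$ distinct vertices. An $(r,k)$-tournament is an $r$-digraph $G$ such that for every $r$-element set $S\subseteq V(G)$, exactly $k$ of the $r!$ orderings of $S$ are edges of $G$. The tight path $P^{(r)}_s$ is the $r$-digraph with $s$ distinct vertices $v_1,\ldots,v_s$ whose edges are exactly the lists of $r$ consecutive vertices $(v_i,\ldots,v_{i+r-1})$, $1\le i\le s-r+1$ (no edges if $s<r$). An $r$-digraph $G$ contains $P^{(r)}_s$ if there is an injection of its vertices into $V(G)$ mapping edges to edges. $f(n,r,k)$ is the maximum integer $s$ such that every $n$-vertex $(r,k)$-tournament contains a copy of $P^{(r)}_s$; thus $f(n,r,k)=n$ means every $n$-vertex $(r,k)$-tournament has a spanning tight path. -}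

module Defs where

open import Data.Fin.Base using (Fin; toℕ)
open import Data.Fin.Properties using (any?; all?; toℕ-injective)
open import Data.Fin.Subset using (Subset; ∣_∣) renaming (_∈_ to _∈ₛ_)
open import Data.Nat.Base using (ℕ; suc; _+_; _*_; _∸_; _≤_; s≤s; NonZero)
import Data.Nat.Properties as ℕ
open import Data.Product.Base using (∃; ∃-syntax; _×_; _,_)
open import Data.Vec.Base using (Vec; lookup; map)
open import Data.Vec.Membership.Propositional using (_∈_)
open import Data.Vec.Properties using (tabulate∘lookup)
open import Data.Vec.Relation.Unary.Unique.Propositional using (Unique)
open import Data.Vec.Relation.Unary.Unique.Propositional.Properties using (tabulate⁺)
open import Function.Bundles using (_⇔_)
open import Function.Definitions using (Injective)
open import Level using (Level; 0ℓ)
open import Relation.Binary.PropositionalEquality using (_≡_; sym; trans; cong; subst)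
open import Relation.Unary using (Pred; Decidable)

-- The entries of xs are, without repetition, exactly the elements of P.
-- It serves both for orderings of a set and for counting: P has exactly m
-- elements when some vector of length m enumerates it.
_Enumerates_ : {a p : Level} {A : Set a} {m : ℕ} → Vec A m → Pred A p → Set _
xs Enumerates P = Unique xs × (∀ x → x ∈ xs ⇔ P x)

HasExactly : {a p : Level} {A : Set a} → ℕ → Pred A p → Set _
HasExactly {A = A} m P = ∃[ xs ] _Enumerates_ {A = A} {m = m} xs P

-- Classically every edge set is decidable; for the tournaments below,
-- decidability also follows from the finite enumeration of the edges.
record Digraph (r n : ℕ) : Set₁ where
  field
    Edge     : Pred (Vec (Fin n) r) 0ℓ
    edge?    : Decidable Edge
    distinct : ∀ {w} → Edge w → Unique w

open Digraph public

IsTournament : {r n : ℕ} → ℕ → Digraph r n → Set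
IsTournament {r} {n} k G =
  (S : Subset n) → ∣ S ∣ ≡ r →
  HasExactly k (λ (w : Vec (Fin n) r) → w Enumerates (_∈ₛ S) × Edge G w)

-- The list w consists of consecutive vertices; the starting point i is
-- 0-based, and Fin (suc s ∸ r) is empty when s < r.
ConsecutiveIn : (r s : ℕ) → Vec (Fin s) r → Set
ConsecutiveIn r s w =
  ∃ λ (i : Fin (suc s ∸ r)) → ∀ (j : Fin r) → toℕ (lookup w j) ≡ toℕ i + toℕ j

tightPath : (r s : ℕ) → Digraph r s
tightPath r s = record
  { Edge     = ConsecutiveIn r s
  ; edge?    = λ w → any? λ i → all? λ j → toℕ (lookup w j) ℕ.≟ toℕ i + toℕ j
  ; distinct = λ {w} (i , eq) →
      subst Unique (tabulate∘lookup w) (tabulate⁺ λ {j} {j′} wj≡wj′ →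
        toℕ-injective (ℕ.+-cancelˡ-≡ (toℕ i) (toℕ j) (toℕ j′)
          (trans (sym (eq j)) (trans (cong toℕ wj≡wj′) (eq j′)))))
  }

_Contains_ : {r n m : ℕ} → Digraph r n → Digraph r m → Set
_Contains_ {r} {n} {m} G H =
  ∃ λ (φ : Fin m → Fin n) →
    Injective _≡_ _≡_ φ × (∀ w → Edge H w → Edge G (map φ w))

Unavoidable : (n r k s : ℕ) → Set₁
Unavoidable n r k s =
  (G : Digraph r n) → IsTournament k G → G Contains tightPath r s

-- f(n,r,k) = s, as a relation: s is the maximum of the unavoidable lengths.
-- A relation is used because the maximum need not exist for all n, r, k:
-- if there are no n-vertex (r,k)-tournaments, every s is unavoidable.
f[_,_,_]≡_ : (n r k s : ℕ) → Set₁
f[ n , r , k ]≡ s =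
  Unavoidable n r k s × (∀ t → Unavoidable n r k t → t ≤ s)

4[r-1]-nonZero : {r : ℕ} → 2 ≤ r → NonZero (4 * (r ∸ 1))
4[r-1]-nonZero (s≤s (s≤s _)) = _

{-# OPTIONS --safe #-}

-- A one-sided local lemma, by counting. Put d = r - 1. Grow words of distinct vertices to the left,
-- calling a word good if every r consecutive letters form an edge. A good word of length m extends
-- in n - m ways, and an extension fails only if its first window is a non-edge. Forgetting the
-- windows that overlap the first one, the failures number at most (1 - k/r!) times the ways of
-- prepending r new letters to a good word of length m - d. Inductively each of the d intermediate
-- steps kept a proportion of at least 1 - 1/(2d) of the extensions, so at least half survive them
-- all; since 1 - k/r! ≤ 1/(4d), the failures are at most a proportion 1/(2d) of the extensions, and
-- good words of length n exist. That f is at most n needs some (r,k)-tournament: take the first k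
-- orderings of every r-set in a fixed enumeration.
module Submission where

open import Defs
open import Data.Nat.Base as ℕ using (ℕ; _∸_; _!)
open import Data.Integer.Base using (+_)
open import Data.Rational.Base using (_/_; 1ℚ; _-_; _*_; _>_)

open import Data.Bool.Base using (true; false; if_then_else_)
open import Data.Fin.Base using (Fin; zero; suc; toℕ; fromℕ; inject≤)
open import Data.Fin.Properties using (toℕ-injective; toℕ-inject≤; toℕ-fromℕ; toℕ<n; injective⇒≤)
  renaming (_≟_ to _≟ᶠ_)
open import Data.Fin.Subset using (Subset; ∣_∣) renaming (_∈_ to _∈ₛ_)
open import Data.Fin.Subset.Properties using (drop-there; ⊆-antisym) renaming (_∈?_ to _∈ₛ?_)
import Data.Integer.Base as ℤ
import Data.Integer.Properties as ℤₚ
open import Data.List.Base as List using (List; []; _∷_; _++_; length; filter; allFin; cartesianProductWith)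
import Data.List.Membership.DecPropositional as ListDec
open import Data.List.Membership.Propositional using () renaming (_∈_ to _∈ₗ_)
open import Data.List.Membership.Propositional.Properties
  using (∈-allFin; ∈-cartesianProductWith⁺; ∈-filter⁺; ∈-filter⁻)
open import Data.List.Membership.Propositional.Properties.WithK using (unique∧set⇒bag)
open import Data.List.Properties using (map-cong; map-∘; map-++; map-tabulate; length-take)
open import Data.List.Relation.Binary.BagAndSetEquality using (∼bag⇒↭)
open import Data.List.Relation.Binary.Permutation.Propositional.Properties using (↭-length)
import Data.List.Relation.Unary.All as Allₗ
import Data.List.Relation.Unary.All.Properties as Allₗₚ
import Data.List.Relation.Unary.AllPairs as AllPairsₗ
import Data.List.Relation.Unary.Any as Anyₗ
open import Data.List.Relation.Unary.Unique.Propositional using () renaming (Unique to Uniqueₗ)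
import Data.List.Relation.Unary.Unique.Propositional.Properties as Uniqueₗ
open import Data.Nat.Base using (zero; suc; _+_; _≤_; _<_; z≤n; s≤s; NonZero)
open import Data.Nat.Combinatorics.Base using (_P′_)
open import Data.Nat.Combinatorics.Specification using (nP′n≡n!)
open import Data.Nat.Induction using (<-rec)
open import Data.Nat.ListAction using (sum)
open import Data.Nat.ListAction.Properties using (sum-++)
import Data.Nat.Properties as ℕₚ
open import Data.Nat.Tactic.RingSolver using (solve-∀)
open import Data.Product.Base using (∃; _×_; _,_; proj₁; proj₂)
import Data.Rational.Base as ℚ
import Data.Rational.Properties as ℚₚ
import Data.Rational.Unnormalised.Base as ℚᵘ
import Data.Rational.Unnormalised.Properties as ℚᵘₚ
open import Data.Sum.Base using (_⊎_; inj₁; inj₂)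
open import Data.Unit.Base using (⊤; tt)
open import Data.Vec.Base as Vec using (Vec; []; _∷_; lookup; tabulate; truncate; toList; fromList)
import Data.Vec.Membership.DecPropositional as VecDec
open import Data.Vec.Membership.Propositional using (_∈_; _∉_)
open import Data.Vec.Membership.Propositional.Properties
  using (∈-allFin⁺; ∈-toList⁺; ∈-toList⁻; ∈-fromList⁺; ∈-fromList⁻)
open import Data.Vec.Relation.Unary.All as All using (All; []; _∷_)
import Data.Vec.Relation.Unary.All.Properties as Allₚ
open import Data.Vec.Properties
  using (tabulate∘lookup; tabulate-cong; lookup∘tabulate; []=⇒lookup; lookup⇒[]=;
         lookup-truncate; lookup-map; truncate-irrelevant; ≡-dec)
open import Data.Vec.Relation.Unary.AllPairs as AllPairs using ([]; _∷_)
open import Data.Vec.Relation.Unary.Any using (here; there)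
open import Data.Vec.Relation.Unary.Unique.Propositional using (Unique)
open import Data.Vec.Relation.Unary.Unique.Propositional.Properties using (tabulate⁺; lookup-injective)
open import Function.Base using (_∘_; id; case_of_)
open import Function.Bundles using (_⇔_; mk⇔; Equivalence)
open import Level using (Level; 0ℓ)
open import Relation.Binary.PropositionalEquality
open import Relation.Nullary.Decidable using (Dec; yes; no; dec-true; does; ¬?; _×-dec_)
open import Relation.Nullary.Negation using (¬_; contradiction)
open import Relation.Unary using (Pred; Decidable)

open Equivalence using (to; from)
module _ {n : ℕ} where open VecDec (_≟ᶠ_ {n}) public using (_∈?_)

private
  variable
    a b ℓ p q : Level
    A : Set a
    B : Set b
    C : Set ℓ
    P : Set p
    Q : Set q
    m n : ℕ

-- Counting as summation of indicators over lists.

♯ : Dec P → ℕ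
♯ P? = if does P? then 1 else 0

♯-mono : (P? : Dec P) (Q? : Dec Q) → (P → Q) → ♯ P? ≤ ♯ Q?
♯-mono (no _)  _       _ = z≤n
♯-mono (yes p) (yes _) _ = ℕₚ.≤-refl
♯-mono (yes p) (no ¬q) f = contradiction (f p) ¬q

♯-cong : (P? : Dec P) (Q? : Dec Q) → P ⇔ Q → ♯ P? ≡ ♯ Q?
♯-cong P? Q? e = ℕₚ.≤-antisym (♯-mono P? Q? (to e)) (♯-mono Q? P? (from e))

♯-split : (P? : Dec P) (Q? : Dec Q) → ♯ P? ≡ ♯ (P? ×-dec Q?) + ♯ (P? ×-dec ¬? Q?)
♯-split (no _)  _       = refl
♯-split (yes _) (yes _) = refl
♯-split (yes _) (no _)  = refl

∑ : List A → (A → ℕ) → ℕ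
∑ xs f = sum (List.map f xs)

∑-cong : (xs : List A) {f g : A → ℕ} → (∀ x → f x ≡ g x) → ∑ xs f ≡ ∑ xs g
∑-cong xs f≗g = cong sum (map-cong f≗g xs)

∑-mono : (xs : List A) {f g : A → ℕ} → (∀ x → f x ≤ g x) → ∑ xs f ≤ ∑ xs g
∑-mono []       f≤g = z≤n
∑-mono (x ∷ xs) f≤g = ℕₚ.+-mono-≤ (f≤g x) (∑-mono xs f≤g)

∑-zero : (xs : List A) → ∑ xs (λ _ → 0) ≡ 0
∑-zero []       = refl
∑-zero (_ ∷ xs) = ∑-zero xs

∑-+ : (xs : List A) (f g : A → ℕ) → ∑ xs (λ x → f x + g x) ≡ ∑ xs f + ∑ xs g
∑-+ []       f g = refl
∑-+ (x ∷ xs) f g = trans (cong₂ _+_ refl (∑-+ xs f g)) (interchange (f x) (g x) _ _)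
  where
  interchange : ∀ a b c d → a + b + (c + d) ≡ a + c + (b + d)
  interchange = solve-∀

∑-*ʳ : (xs : List A) (f : A → ℕ) (c : ℕ) → ∑ xs (λ x → f x ℕ.* c) ≡ ∑ xs f ℕ.* c
∑-*ʳ []       f c = refl
∑-*ʳ (x ∷ xs) f c =
  trans (cong₂ _+_ refl (∑-*ʳ xs f c)) (sym (ℕₚ.*-distribʳ-+ c (f x) _))

∑-++ : (xs ys : List A) (f : A → ℕ) → ∑ (xs ++ ys) f ≡ ∑ xs f + ∑ ys f
∑-++ xs ys f = trans (cong sum (map-++ f xs ys)) (sum-++ (List.map f xs) _)

∑-map : (f : A → B) (xs : List A) (g : B → ℕ) → ∑ (List.map f xs) g ≡ ∑ xs (g ∘ f)
∑-map f xs g = cong sum (sym (map-∘ xs))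

∑-swap : (xs : List A) (ys : List B) (f : A → B → ℕ) →
         ∑ xs (λ x → ∑ ys (f x)) ≡ ∑ ys (λ y → ∑ xs (λ x → f x y))
∑-swap []       ys f = sym (∑-zero ys)
∑-swap (x ∷ xs) ys f = trans (cong₂ _+_ refl (∑-swap xs ys f)) (sym (∑-+ ys (f x) _))

∑-cartesianProductWith : (h : A → B → C) (xs : List A) (ys : List B) (f : C → ℕ) →
  ∑ (cartesianProductWith h xs ys) f ≡ ∑ xs (λ x → ∑ ys (λ y → f (h x y)))
∑-cartesianProductWith h []       ys f = refl
∑-cartesianProductWith h (x ∷ xs) ys f =
  trans (∑-++ (List.map (h x) ys) _ f)
        (cong₂ _+_ (∑-map (h x) ys f) (∑-cartesianProductWith h xs ys f))

count : {P : Pred A p} → Decidable P → List A → ℕ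
count P? xs = ∑ xs (λ x → ♯ (P? x))

module _ {P : Pred A p} (P? : Decidable P) where

  count-none : (xs : List A) → (∀ x → ¬ P x) → count P? xs ≡ 0
  count-none xs ¬P = trans (∑-cong xs λ x → none (P? x) (¬P x)) (∑-zero xs)
    where
    none : {Q : Set q} (Q? : Dec Q) → ¬ Q → ♯ Q? ≡ 0
    none (yes q) ¬q = contradiction q ¬q
    none (no _)  _  = refl

  count≡0⇒none : ∀ {x} (xs : List A) → count P? xs ≡ 0 → x ∈ₗ xs → ¬ P x
  count≡0⇒none (x ∷ xs) eq (Anyₗ.here refl) px with P? x
  ... | no ¬px = ¬px px
  count≡0⇒none (x ∷ xs) eq (Anyₗ.there x∈) px = count≡0⇒none xs (ℕₚ.m+n≡0⇒n≡0 (♯ (P? x)) eq) x∈ px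

  count>0⇒∃ : (xs : List A) → 0 < count P? xs → ∃ P
  count>0⇒∃ (x ∷ xs) pos with P? x
  ... | yes px = x , px
  ... | no  _  = count>0⇒∃ xs pos

  length-filter≡count : (xs : List A) → length (filter P? xs) ≡ count P? xs
  length-filter≡count []       = refl
  length-filter≡count (x ∷ xs) with P? x
  ... | yes _ = cong suc (length-filter≡count xs)
  ... | no  _ = length-filter≡count xs

module _ {P : Pred A p} {Q : Pred A q} (P? : Decidable P) (Q? : Decidable Q) where

  count-cong : (xs : List A) → (∀ x → P x ⇔ Q x) → count P? xs ≡ count Q? xs
  count-cong xs P⇔Q = ∑-cong xs λ x → ♯-cong (P? x) (Q? x) (P⇔Q x)

  count-split : (xs : List A) →
    count P? xs ≡ count (λ x → P? x ×-dec Q? x) xs + count (λ x → P? x ×-dec ¬? (Q? x)) xs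
  count-split xs = trans (∑-cong xs λ x → ♯-split (P? x) (Q? x)) (∑-+ xs _ _)

module _ {P : Pred A p} {R : A → Pred B q} (P? : Decidable P) (R? : ∀ x → Decidable (R x))
         (xs : List A) (ys : List B) where

  -- Double counting for fibres of size c/d, kept free of division: the size of the non-edge fibres
  -- is known only after multiplication by `r !`.
  ∑-fibres-* : ∀ d c → (∀ x → P x → count (R? x) ys ℕ.* d ≡ c) →
    ∑ xs (λ x → count (λ y → P? x ×-dec R? x y) ys) ℕ.* d ≡ count P? xs ℕ.* c
  ∑-fibres-* d c fibre = begin
    ∑ xs (λ x → count (λ y → P? x ×-dec R? x y) ys) ℕ.* d  ≡⟨ ∑-*ʳ xs _ d ⟨
    ∑ xs (λ x → count (λ y → P? x ×-dec R? x y) ys ℕ.* d)  ≡⟨ ∑-cong xs (λ x → pointwise x (P? x)) ⟩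
    ∑ xs (λ x → ♯ (P? x) ℕ.* c)                            ≡⟨ ∑-*ʳ xs _ c ⟩
    count P? xs ℕ.* c                                      ∎
    where
    open ≡-Reasoning
    pointwise : ∀ x (P?x : Dec (P x)) → count (λ y → P?x ×-dec R? x y) ys ℕ.* d ≡ ♯ P?x ℕ.* c
    pointwise x (yes px) = trans (fibre x px) (sym (ℕₚ.+-identityʳ c))
    pointwise x (no _)   = cong (ℕ._* d) (∑-zero ys)

  ∑-fibres : ∀ c → (∀ x → P x → count (R? x) ys ≡ c) →
    ∑ xs (λ x → count (λ y → P? x ×-dec R? x y) ys) ≡ count P? xs ℕ.* c
  ∑-fibres c fibre = trans (sym (ℕₚ.*-identityʳ _))
    (∑-fibres-* 1 c λ x px → trans (ℕₚ.*-identityʳ _) (fibre x px))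

-- Enumerations as vectors and as lists.

toList-unique : {xs : Vec A m} → Unique xs → Uniqueₗ (toList xs)
toList-unique []         = AllPairsₗ.[]
toList-unique (x∉ ∷ xs!) = Allₚ.toList⁺ x∉ AllPairsₗ.∷ toList-unique xs!

fromList-unique : {xs : List A} → Uniqueₗ xs → Unique (fromList xs)
fromList-unique AllPairsₗ.[]         = []
fromList-unique (x∉ AllPairsₗ.∷ xs!) = Allₚ.fromList⁺ x∉ ∷ fromList-unique xs!

length-toList : (xs : Vec A m) → length (toList xs) ≡ m
length-toList []       = refl
length-toList (x ∷ xs) = cong suc (length-toList xs)

hasExactly-fromList : {P : Pred A p} {xs : List A} → Uniqueₗ xs → (∀ x → x ∈ₗ xs ⇔ P x) →
                      HasExactly (length xs) P
hasExactly-fromList {xs = xs} xs! x∈⇔P =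
  fromList xs , fromList-unique xs! , λ x → mk⇔ (to (x∈⇔P x) ∘ ∈-fromList⁻) (∈-fromList⁺ ∘ from (x∈⇔P x))

-- Two duplicate-free lists with the same members are permutations of each other, so every
-- enumeration of `P` has the length of the list obtained by filtering `L`.
count-enumerates : {P : Pred A p} (P? : Decidable P) {L : List A} → Uniqueₗ L → (∀ x → x ∈ₗ L) →
                   {xs : Vec A m} → xs Enumerates P → count P? L ≡ m
count-enumerates P? {L} L! all∈ {xs} (xs! , x∈⇔P) = begin
  count P? L              ≡⟨ length-filter≡count P? L ⟨
  length (filter P? L)    ≡⟨ ↭-length (∼bag⇒↭
                               (unique∧set⇒bag (Uniqueₗ.filter⁺ P? L!) (toList-unique xs!) same)) ⟩
  length (toList xs)      ≡⟨ length-toList xs ⟩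
  _                       ∎
  where
  open ≡-Reasoning
  same : ∀ {x} → x ∈ₗ filter P? L ⇔ x ∈ₗ toList xs
  same {x} = mk⇔ (λ x∈ → ∈-toList⁺ (from (x∈⇔P x) (proj₂ (∈-filter⁻ P? {xs = L} x∈))))
                 (λ x∈ → ∈-filter⁺ P? (all∈ x) (to (x∈⇔P x) (∈-toList⁻ x∈)))

-- Words over the vertex set.

words : ∀ m → List (Vec (Fin n) m)
words zero    = [] ∷ []
words (suc m) = cartesianProductWith _∷_ (allFin _) (words m)

words-unique : ∀ m → Uniqueₗ (words {n} m)
words-unique zero    = Allₗ.[] AllPairsₗ.∷ AllPairsₗ.[]
words-unique (suc m) =
  Uniqueₗ.cartesianProductWith⁺ _∷_ (λ { refl → refl , refl }) (Uniqueₗ.allFin⁺ _) (words-unique m)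

∈-words : (w : Vec (Fin n) m) → w ∈ₗ words m
∈-words []      = Anyₗ.here refl
∈-words (v ∷ w) = ∈-cartesianProductWith⁺ _∷_ (∈-allFin v) (∈-words w)

-- The suffix is summed outermost because words grow to the left: later a good suffix is fixed while
-- the window in front of it varies.
∑-words-++ : ∀ i j (f : Vec (Fin n) (i + j) → ℕ) →
  ∑ (words (i + j)) f ≡ ∑ (words j) (λ z → ∑ (words i) (λ u → f (u Vec.++ z)))
∑-words-++ zero    j f = ∑-cong (words j) λ z → sym (ℕₚ.+-identityʳ (f z))
∑-words-++ {n} (suc i) j f = begin
  ∑ (words (suc i + j)) f
    ≡⟨ ∑-cartesianProductWith _∷_ (allFin n) (words (i + j)) f ⟩
  ∑ (allFin n) (λ v → ∑ (words (i + j)) (λ w → f (v ∷ w)))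
    ≡⟨ ∑-cong (allFin n) (λ v → ∑-words-++ i j (λ w → f (v ∷ w))) ⟩
  ∑ (allFin n) (λ v → ∑ (words j) (λ z → ∑ (words i) (λ u → f (v ∷ u Vec.++ z))))
    ≡⟨ ∑-swap (allFin n) (words j) _ ⟩
  ∑ (words j) (λ z → ∑ (allFin n) (λ v → ∑ (words i) (λ u → f (v ∷ u Vec.++ z))))
    ≡⟨ ∑-cong (words j) (λ z → ∑-cartesianProductWith _∷_ (allFin n) (words i) _) ⟨
  ∑ (words j) (λ z → ∑ (words (suc i)) (λ u → f (u Vec.++ z))) ∎
  where open ≡-Reasoning

-- Words of distinct letters from a given set.

unique? : (w : Vec (Fin n) m) → Dec (Unique w)
unique? = AllPairs.allPairs? λ x y → ¬? (x ≟ᶠ y)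

∉⇒All≢ : {x : A} {xs : Vec A m} → x ∉ xs → All (x ≢_) xs
∉⇒All≢ {xs = []}    _  = []
∉⇒All≢ {xs = _ ∷ _} x∉ = (x∉ ∘ here) ∷ ∉⇒All≢ (x∉ ∘ there)

All≢⇒∉ : {x : A} {xs : Vec A m} → All (x ≢_) xs → x ∉ xs
All≢⇒∉ (x≢ ∷ _)  (here refl) = x≢ refl
All≢⇒∉ (_  ∷ xs) (there x∈)  = All≢⇒∉ xs x∈

All-∈ : {P : Pred A p} {xs : Vec A m} → (∀ {x} → x ∈ xs → P x) → All P xs
All-∈ {xs = []}    _ = []
All-∈ {xs = _ ∷ _} f = f (here refl) ∷ All-∈ (f ∘ there)

∈-All : {P : Pred A p} {xs : Vec A m} {x : A} → All P xs → x ∈ xs → P x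
∈-All (px ∷ _)  (here refl) = px
∈-All (_ ∷ pxs) (there x∈)  = ∈-All pxs x∈

-- Only inclusion in `P` is demanded, so partial orderings are covered and can be counted letter by
-- letter; at full length an arrangement is an ordering of `P`, by `arrangement-enumerates`.
Arrangement : Pred (Fin n) p → Pred (Vec (Fin n) m) p
Arrangement P w = Unique w × All P w

module _ {P : Pred (Fin n) p} where

  arrangement-∷ : ∀ {v} {w : Vec (Fin n) m} → Arrangement P (v ∷ w) ⇔ (Arrangement P w × (P v × v ∉ w))
  arrangement-∷ = mk⇔ (λ { (v∉ ∷ w! , pv ∷ pw) → (w! , pw) , pv , All≢⇒∉ v∉ })
                      (λ { ((w! , pw) , pv , v∉) → ∉⇒All≢ v∉ ∷ w! , pv ∷ pw })

  module _ (P? : Decidable P) where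

    arrangement? : Decidable (Arrangement {m = m} P)
    arrangement? w = unique? w ×-dec All.all? P? w

    unused? : (w : Vec (Fin n) m) → Decidable (λ v → P v × v ∉ w)
    unused? w v = P? v ×-dec ¬? (v ∈? w)

    -- The elements of `P` split into those occurring in `w`, which `w` itself enumerates, and the
    -- rest.
    count-unused : {w : Vec (Fin n) m} → Arrangement P w →
                   count (unused? w) (allFin n) ≡ count P? (allFin n) ∸ m
    count-unused {m} {w} (w! , pw) = begin
      unused              ≡⟨ ℕₚ.m+n∸m≡n m unused ⟨
      m + unused ∸ m      ≡⟨ cong (λ x → x + unused ∸ m) used ⟨
      _ + unused ∸ m      ≡⟨ cong (_∸ m) (count-split P? (_∈? w) (allFin n)) ⟨
      count P? (allFin n) ∸ m ∎
      where
      open ≡-Reasoning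
      unused = count (unused? w) (allFin n)
      used : count (λ v → P? v ×-dec (v ∈? w)) (allFin n) ≡ m
      used = count-enumerates (λ v → P? v ×-dec (v ∈? w)) (Uniqueₗ.allFin⁺ n) ∈-allFin
               (w! , λ v → mk⇔ (λ v∈ → ∈-All pw v∈ , v∈) proj₂)

    arrangement-enumerates : {w : Vec (Fin n) m} → Arrangement P w → count P? (allFin n) ≡ m →
                             w Enumerates P
    arrangement-enumerates {m} {w} (w! , pw) #P≡m = w! , λ v → mk⇔ (∈-All pw) (covered v)
      where
      covered : ∀ v → P v → v ∈ w
      covered v pv with v ∈? w
      ... | yes v∈ = v∈
      ... | no v∉  = contradiction (pv , v∉) (count≡0⇒none (unused? w) (allFin n)
        (trans (count-unused (w! , pw)) (trans (cong (_∸ m) #P≡m) (ℕₚ.n∸n≡0 m))) (∈-allFin v))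

    count-arrangements : ∀ m → count arrangement? (words m) ≡ count P? (allFin n) P′ m
    count-arrangements zero    = refl
    count-arrangements (suc m) = begin
      count arrangement? (words (suc m))
        ≡⟨ ∑-cartesianProductWith _∷_ (allFin n) (words m) _ ⟩
      ∑ (allFin n) (λ v → count (λ w → arrangement? (v ∷ w)) (words m))
        ≡⟨ ∑-swap (allFin n) (words m) _ ⟩
      ∑ (words m) (λ w → count (λ v → arrangement? (v ∷ w)) (allFin n))
        ≡⟨ ∑-cong (words m) (λ w → count-cong (λ v → arrangement? (v ∷ w))
              (λ v → arrangement? w ×-dec unused? w v) (allFin n) (λ v → arrangement-∷)) ⟩
      ∑ (words m) (λ w → count (λ v → arrangement? w ×-dec unused? w v) (allFin n))
        ≡⟨ ∑-fibres arrangement? unused? (words m) (allFin n) (count P? (allFin n) ∸ m) (λ w → count-unused) ⟩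
      count arrangement? (words m) ℕ.* (count P? (allFin n) ∸ m)
        ≡⟨ ℕₚ.*-comm _ (count P? (allFin n) ∸ m) ⟩
      (count P? (allFin n) ∸ m) ℕ.* count arrangement? (words m)
        ≡⟨ cong ((count P? (allFin n) ∸ m) ℕ.*_) (count-arrangements m) ⟩
      (count P? (allFin n) ∸ m) ℕ.* (count P? (allFin n) P′ m) ∎
      where open ≡-Reasoning

module _ {w : Vec (Fin n) m} (w! : Unique w) where

  count-∈ : count (_∈? w) (allFin n) ≡ m
  count-∈ = count-enumerates (_∈? w) (Uniqueₗ.allFin⁺ n) ∈-allFin (w! , λ v → mk⇔ id id)

  count-∉ : count (λ v → ¬? (v ∈? w)) (allFin n) ≡ n ∸ m
  count-∉ = begin
    count (λ v → ¬? (v ∈? w)) (allFin n)  ≡⟨ count-cong (λ v → ¬? (v ∈? w)) (unused? ⊤? w) (allFin n)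
                                                          (λ v → mk⇔ (tt ,_) proj₂) ⟩
    count (unused? ⊤? w) (allFin n)       ≡⟨ count-unused ⊤? (w! , All.universal (λ _ → tt) w) ⟩
    count ⊤? (allFin n) ∸ m               ≡⟨ cong (_∸ m) count-⊤ ⟩
    n ∸ m                                 ∎
    where
    open ≡-Reasoning
    ⊤? : Decidable {A = Fin n} (λ _ → ⊤)
    ⊤? _ = yes tt
    count-⊤ : count ⊤? (allFin n) ≡ n
    count-⊤ = count-enumerates ⊤? (Uniqueₗ.allFin⁺ n) ∈-allFin {xs = Vec.allFin n}
                (tabulate⁺ id , λ v → mk⇔ (λ _ → tt) (λ _ → ∈-allFin⁺ v))

  arrangement-∈-⊇ : {u : Vec (Fin n) m} → Arrangement (_∈ w) u → ∀ {v} → v ∈ w → v ∈ u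
  arrangement-∈-⊇ u-arr = from (proj₂ (arrangement-enumerates (_∈? w) u-arr count-∈) _)

-- From words to vertex subsets.

support : Vec (Fin n) m → Subset n
support w = tabulate (λ v → does (v ∈? w))

∈-support : ∀ {v} {w : Vec (Fin n) m} → v ∈ₛ support w ⇔ v ∈ w
∈-support {v = v} {w} = mk⇔
  (λ v∈S → does⇒ (v ∈? w) (trans (sym (lookup∘tabulate _ v)) ([]=⇒lookup v∈S)))
  (λ v∈w → lookup⇒[]= v _ (trans (lookup∘tabulate _ v) (dec-true (v ∈? w) v∈w)))
  where
  does⇒ : {P : Set p} (P? : Dec P) → does P? ≡ true → P
  does⇒ (yes p) _ = p

∣∣≡count : (S : Subset n) → ∣ S ∣ ≡ count (_∈ₛ? S) (allFin n)
∣∣≡count []      = refl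
∣∣≡count {suc n} (s ∷ S) = begin
  ∣ s ∷ S ∣
    ≡⟨ head s ⟩
  ♯ (zero ∈ₛ? (s ∷ S)) + ∣ S ∣
    ≡⟨ cong₂ _+_ refl (∣∣≡count S) ⟩
  ♯ (zero ∈ₛ? (s ∷ S)) + count (_∈ₛ? S) (allFin n)
    ≡⟨ cong₂ _+_ refl (count-cong (_∈ₛ? S) (λ v → suc v ∈ₛ? (s ∷ S)) (allFin n)
                              (λ v → mk⇔ Vec.there drop-there)) ⟩
  ♯ (zero ∈ₛ? (s ∷ S)) + ∑ (allFin n) (λ v → ♯ (suc v ∈ₛ? (s ∷ S)))
    ≡⟨ cong₂ _+_ refl (∑-map suc (allFin n) _) ⟨
  ♯ (zero ∈ₛ? (s ∷ S)) + count (_∈ₛ? (s ∷ S)) (List.map suc (allFin n))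
    ≡⟨ cong (λ xs → ♯ (zero ∈ₛ? (s ∷ S)) + count (_∈ₛ? (s ∷ S)) xs) (map-tabulate id suc) ⟩
  count (_∈ₛ? (s ∷ S)) (allFin (suc n)) ∎
  where
  open ≡-Reasoning
  head : ∀ s → ∣ s ∷ S ∣ ≡ ♯ (zero ∈ₛ? (s ∷ S)) + ∣ S ∣
  head true  = refl
  head false = refl

∣support∣ : {w : Vec (Fin n) m} → Unique w → ∣ support w ∣ ≡ m
∣support∣ {w = w} w! = begin
  ∣ support w ∣                      ≡⟨ ∣∣≡count (support w) ⟩
  count (_∈ₛ? support w) (allFin _)  ≡⟨ count-cong (_∈ₛ? support w) (_∈? w) (allFin _) (λ v → ∈-support) ⟩
  count (_∈? w) (allFin _)           ≡⟨ count-∈ w! ⟩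
  _                                  ∎
  where open ≡-Reasoning

-- Density of edges among the arrangements of a vertex set.

module _ {r k : ℕ} (G : Digraph r n) (tournament : IsTournament k G) where

  -- The tournament hypothesis at `support u`, with vertex sets replaced by words: an arrangement of
  -- length `r` of the entries of `u` is an ordering of that set.
  count-edges-∈ : {u : Vec (Fin n) r} → Unique u →
    count (λ w → arrangement? (_∈? u) w ×-dec edge? G w) (words r) ≡ k
  count-edges-∈ {u} u! with xs , xs! , xs∈⇔ ← tournament (support u) (∣support∣ u!) =
    count-enumerates (λ w → arrangement? (_∈? u) w ×-dec edge? G w) (words-unique r) ∈-words {xs}
      (xs! , λ w → mk⇔ (arr ∘ to (xs∈⇔ w)) (from (xs∈⇔ w) ∘ enum))
    where
    arr : ∀ {w} → w Enumerates (_∈ₛ support u) × Edge G w → Arrangement (_∈ u) w × Edge G w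
    arr ((w! , v∈⇔) , e) = (w! , All-∈ λ {v} v∈ → to ∈-support (to (v∈⇔ v) v∈)) , e
    enum : ∀ {w} → Arrangement (_∈ u) w × Edge G w → w Enumerates (_∈ₛ support u) × Edge G w
    enum ((w! , w⊆u) , e) =
      (w! , λ v → mk⇔ (λ v∈ → from ∈-support (∈-All w⊆u v∈))
                      (λ v∈ → arrangement-∈-⊇ u! (w! , w⊆u) (to ∈-support v∈))) , e

  module _ {P : Pred (Fin n) p} (P? : Decidable P) where

    private
      edges non-edges total : ℕ
      edges     = count (λ u → arrangement? P? u ×-dec edge? G u) (words r)
      non-edges = count (λ u → arrangement? P? u ×-dec ¬? (edge? G u)) (words r)
      total     = count (arrangement? P?) (words r)

    -- Both sides count the pairs (u , w) of arrangements of P with the same entries, w being an edge.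
    count-edges : edges ℕ.* r ! ≡ total ℕ.* k
    count-edges = begin
      edges ℕ.* r !
        ≡⟨ ∑-fibres (λ w → arrangement? P? w ×-dec edge? G w) (λ w → arrangement? (_∈? w))
                    (words r) (words r) (r !) orderings ⟨
      ∑ (words r) (λ w → count (λ u → (arrangement? P? w ×-dec edge? G w) ×-dec arrangement? (_∈? w) u)
                           (words r))
        ≡⟨ ∑-cong (words r) (λ w → ∑-cong (words r) (λ u →
             ♯-cong ((arrangement? P? w ×-dec edge? G w) ×-dec arrangement? (_∈? w) u) (pair? u w)
                    exchange)) ⟩
      ∑ (words r) (λ w → ∑ (words r) (λ u → ♯ (pair? u w)))
        ≡⟨ ∑-swap (words r) (words r) _ ⟩
      ∑ (words r) (λ u → count (pair? u) (words r))
        ≡⟨ ∑-fibres (arrangement? P?) (λ u w → arrangement? (_∈? u) w ×-dec edge? G w)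
                    (words r) (words r) k (λ { _ (u! , _) → count-edges-∈ u! }) ⟩
      total ℕ.* k ∎
      where
      open ≡-Reasoning
      pair? : ∀ u w → Dec (Arrangement P u × Arrangement (_∈ u) w × Edge G w)
      pair? u w = arrangement? P? u ×-dec (arrangement? (_∈? u) w ×-dec edge? G w)
      orderings : ∀ w → Arrangement P w × Edge G w → count (arrangement? (_∈? w)) (words r) ≡ r !
      orderings w ((w! , _) , _) =
        trans (count-arrangements (_∈? w) r) (trans (cong (_P′ r) (count-∈ w!)) (nP′n≡n! r))
      exchange : ∀ {u w} → ((Arrangement P w × Edge G w) × Arrangement (_∈ w) u) ⇔
                           (Arrangement P u × Arrangement (_∈ u) w × Edge G w)
      exchange = mk⇔
        (λ { (((w! , pw) , e) , (u! , u⊆w)) →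
             (u! , All.map (∈-All pw) u⊆w) , (w! , All-∈ (arrangement-∈-⊇ w! (u! , u⊆w))) , e })
        (λ { ((u! , pu) , (w! , w⊆u) , e) →
             ((w! , All.map (∈-All pu) w⊆u) , e) , (u! , All-∈ (arrangement-∈-⊇ u! (w! , w⊆u))) })

    -- The complement of `count-edges`: a proportion 1 - k/r! of the arrangements are non-edges,
    -- whatever `P` is. It is applied to the letters outside a good suffix.
    count-non-edges : non-edges ℕ.* r ! ≡ (r ! ∸ k) ℕ.* (count P? (allFin n) P′ r)
    count-non-edges = begin
      non-edges ℕ.* r !
        ≡⟨ ℕₚ.m+n∸m≡n (edges ℕ.* r !) _ ⟨
      edges ℕ.* r ! + non-edges ℕ.* r ! ∸ edges ℕ.* r !
        ≡⟨ cong (_∸ edges ℕ.* r !) (ℕₚ.*-distribʳ-+ (r !) edges non-edges) ⟨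
      (edges + non-edges) ℕ.* r ! ∸ edges ℕ.* r !
        ≡⟨ cong₂ (λ x y → x ℕ.* r ! ∸ y) (sym (count-split (arrangement? P?) (edge? G) (words r)))
                                         count-edges ⟩
      total ℕ.* r ! ∸ total ℕ.* k
        ≡⟨ ℕₚ.*-distribˡ-∸ total (r !) k ⟨
      total ℕ.* (r ! ∸ k)
        ≡⟨ ℕₚ.*-comm total _ ⟩
      (r ! ∸ k) ℕ.* total
        ≡⟨ cong ((r ! ∸ k) ℕ.*_) (count-arrangements P? r) ⟩
      (r ! ∸ k) ℕ.* (count P? (allFin n) P′ r) ∎
      where open ≡-Reasoning

-- The numerical recurrence behind the local lemma.

-- C m counts the good words of length m, and B m the words of length suc m whose last m letters
-- form a good word but whose first window is not an edge. Such a window has suc d letters, and `big`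
-- requires goodness only of the j letters after it.
module Recurrence
  (n d b D : ℕ) .{{_ : NonZero d}} .{{_ : NonZero D}} (C B : ℕ → ℕ)
  (4db≤D : 4 ℕ.* d ℕ.* b ≤ D)
  (C₀>0  : 0 < C 0)
  (step  : ∀ m → C (suc m) + B m ≡ C m ℕ.* (n ∸ m))
  (small : ∀ m → m < d → B m ≡ 0)
  (big   : ∀ j → B (d + j) ℕ.* D ≤ C j ℕ.* (b ℕ.* ((n ∸ j) P′ suc d)))
  where

  open ℕₚ.≤-Reasoning

  private
    2d c : ℕ
    2d = 2 ℕ.* d
    c = ℕ.pred 2d

    instance
      2d≢0 : NonZero 2d
      2d≢0 = ℕₚ.m*n≢0 2 d

    suc-c : suc c ≡ 2d
    suc-c = ℕₚ.suc-pred 2d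

  -- With denominators cleared: at least a proportion 1 - 1/(2d) of the extensions of good words of
  -- length `m` are good.
  Grows : ℕ → Set
  Grows m = C m ℕ.* (n ∸ m) ℕ.* c ≤ C (suc m) ℕ.* 2d

  -- Bernoulli's inequality (1 - 1/(2d))^i ≥ 1 - i/(2d), with the powers never formed.
  grows-iterated : ∀ j i → (∀ {m} → m < j + i → Grows m) →
    C j ℕ.* ((n ∸ j) P′ i) ℕ.* (2d ∸ i) ≤ C (j + i) ℕ.* 2d
  grows-iterated j zero    _     = begin
    C j ℕ.* 1 ℕ.* 2d  ≡⟨ cong₂ ℕ._*_ (trans (ℕₚ.*-identityʳ _) (cong C (sym (ℕₚ.+-identityʳ j)))) refl ⟩
    C (j + 0) ℕ.* 2d  ∎
  -- The induction hypothesis and `grows` at `j + i` each bring a factor `2d`, so the inequality is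
  -- proved with an extra `2d` on both sides.
  grows-iterated j (suc i) grows = ℕₚ.*-cancelʳ-≤ _ _ 2d (begin
    C j ℕ.* (e ℕ.* F) ℕ.* (2d ∸ suc i) ℕ.* 2d
      ≡⟨ regroup₁ (C j) e F (2d ∸ suc i) 2d ⟩
    C j ℕ.* F ℕ.* e ℕ.* ((2d ∸ suc i) ℕ.* 2d)
      ≤⟨ ℕₚ.*-monoʳ-≤ (C j ℕ.* F ℕ.* e) bernoulli ⟩
    C j ℕ.* F ℕ.* e ℕ.* (c ℕ.* (2d ∸ i))
      ≡⟨ regroup₂ (C j) F e c (2d ∸ i) ⟩
    C j ℕ.* F ℕ.* (2d ∸ i) ℕ.* (e ℕ.* c)
      ≤⟨ ℕₚ.*-monoˡ-≤ (e ℕ.* c) (grows-iterated j i (λ m< → grows (ℕₚ.<-trans m< j+i<))) ⟩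
    C (j + i) ℕ.* 2d ℕ.* (e ℕ.* c)
      ≡⟨ regroup₃ (C (j + i)) 2d e c ⟩
    C (j + i) ℕ.* e ℕ.* c ℕ.* 2d
      ≡⟨ cong (λ x → C (j + i) ℕ.* x ℕ.* c ℕ.* 2d) (ℕₚ.∸-+-assoc n j i) ⟩
    C (j + i) ℕ.* (n ∸ (j + i)) ℕ.* c ℕ.* 2d
      ≤⟨ ℕₚ.*-monoˡ-≤ 2d (grows j+i<) ⟩
    C (suc (j + i)) ℕ.* 2d ℕ.* 2d
      ≡⟨ cong (λ x → C x ℕ.* 2d ℕ.* 2d) (ℕₚ.+-suc j i) ⟨
    C (j + suc i) ℕ.* 2d ℕ.* 2d ∎)
    where
    e F : ℕ
    e = n ∸ j ∸ i
    F = (n ∸ j) P′ i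
    j+i< : j + i < j + suc i
    j+i< = ℕₚ.≤-reflexive (sym (ℕₚ.+-suc j i))
    regroup₁ : ∀ x e f t k → x ℕ.* (e ℕ.* f) ℕ.* t ℕ.* k ≡ x ℕ.* f ℕ.* e ℕ.* (t ℕ.* k)
    regroup₁ = solve-∀
    regroup₂ : ∀ x f e c t → x ℕ.* f ℕ.* e ℕ.* (c ℕ.* t) ≡ x ℕ.* f ℕ.* t ℕ.* (e ℕ.* c)
    regroup₂ = solve-∀
    regroup₃ : ∀ y k e c → y ℕ.* k ℕ.* (e ℕ.* c) ≡ y ℕ.* e ℕ.* c ℕ.* k
    regroup₃ = solve-∀
    -- This is 1 - (i+1)/(2d) ≤ (1 - 1/(2d))(1 - i/(2d)). Beyond `c` the left side is truncated to
    -- zero, hence the case distinction in `step-bound`.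
    bernoulli : (2d ∸ suc i) ℕ.* 2d ≤ c ℕ.* (2d ∸ i)
    bernoulli = begin
      (2d ∸ suc i) ℕ.* 2d              ≡⟨ cong₂ (λ x y → (x ∸ suc i) ℕ.* y) (sym suc-c) (sym suc-c) ⟩
      (c ∸ i) ℕ.* suc c                ≡⟨ ℕₚ.*-suc (c ∸ i) c ⟩
      c ∸ i + (c ∸ i) ℕ.* c            ≡⟨ cong₂ _+_ refl (ℕₚ.*-comm (c ∸ i) c) ⟩
      c ∸ i + c ℕ.* (c ∸ i)            ≤⟨ step-bound (ℕₚ.≤-total i c) ⟩
      c ℕ.* (suc c ∸ i)                ≡⟨ cong (λ x → c ℕ.* (x ∸ i)) suc-c ⟩
      c ℕ.* (2d ∸ i)                   ∎
      where
      step-bound : i ≤ c ⊎ c ≤ i → c ∸ i + c ℕ.* (c ∸ i) ≤ c ℕ.* (suc c ∸ i)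
      step-bound (inj₁ i≤c) = begin
        c ∸ i + c ℕ.* (c ∸ i)  ≤⟨ ℕₚ.+-monoˡ-≤ _ (ℕₚ.m∸n≤m c i) ⟩
        c + c ℕ.* (c ∸ i)      ≡⟨ ℕₚ.*-suc c (c ∸ i) ⟨
        c ℕ.* suc (c ∸ i)      ≡⟨ cong (c ℕ.*_) (ℕₚ.+-∸-assoc 1 i≤c) ⟨
        c ℕ.* (suc c ∸ i)      ∎
      step-bound (inj₂ c≤i) = begin
        c ∸ i + c ℕ.* (c ∸ i)  ≡⟨ cong (λ x → x + c ℕ.* x) (ℕₚ.m≤n⇒m∸n≡0 c≤i) ⟩
        0 + c ℕ.* 0            ≡⟨ ℕₚ.*-zeroʳ c ⟩
        0                      ≤⟨ z≤n ⟩
        c ℕ.* (suc c ∸ i)      ∎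

  -- By `step`, every extension is good or lost; losing at most 1/(2d) of them leaves 1 - 1/(2d).
  few-losses⇒grows : ∀ m → B m ℕ.* 2d ≤ C m ℕ.* (n ∸ m) → Grows m
  few-losses⇒grows m loss = ℕₚ.+-cancelʳ-≤ X _ _ (begin
    X ℕ.* c + X                       ≡⟨ ℕₚ.+-comm (X ℕ.* c) X ⟩
    X + X ℕ.* c                       ≡⟨ ℕₚ.*-suc X c ⟨
    X ℕ.* suc c                       ≡⟨ cong₂ ℕ._*_ (sym (step m)) suc-c ⟩
    (C (suc m) + B m) ℕ.* 2d          ≡⟨ ℕₚ.*-distribʳ-+ 2d (C (suc m)) (B m) ⟩
    C (suc m) ℕ.* 2d + B m ℕ.* 2d     ≤⟨ ℕₚ.+-monoʳ-≤ (C (suc m) ℕ.* 2d) loss ⟩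
    C (suc m) ℕ.* 2d + X              ∎)
    where
    X : ℕ
    X = C m ℕ.* (n ∸ m)

  -- The heart of the argument. `big` compares the losses with `C j`, and the `d` growth steps from
  -- `j` to `d + j` keep at least half of all extensions. The losses are thus at most twice b/D,
  -- hence at most 1/(2d), of the extensions at `d + j`.
  few-losses : ∀ j → (∀ {m} → m < d + j → Grows m) →
               B (d + j) ℕ.* 2d ≤ C (d + j) ℕ.* (n ∸ (d + j))
  few-losses j grows = ℕₚ.*-cancelʳ-≤ _ _ D (begin
    B (d + j) ℕ.* 2d ℕ.* D                    ≡⟨ regroup₁ (B (d + j)) 2d D ⟩
    2d ℕ.* (B (d + j) ℕ.* D)                  ≤⟨ ℕₚ.*-monoʳ-≤ 2d (big j) ⟩
    -- The falling factorial of length `suc d` unfolds to `e` times `F`: `F` is matched by the `d`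
    -- growth steps, `e` by the extension at `d + j`.
    2d ℕ.* (C j ℕ.* (b ℕ.* (e ℕ.* F)))        ≡⟨ regroup₂ d (C j) b e F ⟩
    2 ℕ.* b ℕ.* e ℕ.* (C j ℕ.* F ℕ.* d)       ≤⟨ ℕₚ.*-monoʳ-≤ (2 ℕ.* b ℕ.* e) iterated ⟩
    2 ℕ.* b ℕ.* e ℕ.* (C (d + j) ℕ.* 2d)      ≡⟨ regroup₃ b e (C (d + j)) d ⟩
    C (d + j) ℕ.* e ℕ.* (4 ℕ.* d ℕ.* b)       ≤⟨ ℕₚ.*-monoʳ-≤ (C (d + j) ℕ.* e) 4db≤D ⟩
    C (d + j) ℕ.* e ℕ.* D                     ≡⟨ cong (λ x → C (d + j) ℕ.* x ℕ.* D) e≡ ⟩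
    C (d + j) ℕ.* (n ∸ (d + j)) ℕ.* D         ∎)
    where
    e F : ℕ
    e = n ∸ j ∸ d
    F = (n ∸ j) P′ d
    e≡ : e ≡ n ∸ (d + j)
    e≡ = trans (ℕₚ.∸-+-assoc n j d) (cong (n ∸_) (ℕₚ.+-comm j d))
    2d∸d : 2d ∸ d ≡ d
    2d∸d = trans (ℕₚ.m+n∸m≡n d (d + 0)) (ℕₚ.+-identityʳ d)
    -- At `i = d` the Bernoulli factor `2d ∸ i` equals `d`, which is the surviving half.
    iterated : C j ℕ.* F ℕ.* d ≤ C (d + j) ℕ.* 2d
    iterated = subst₂ (λ x y → C j ℕ.* F ℕ.* x ≤ C y ℕ.* 2d) 2d∸d (ℕₚ.+-comm j d)
      (grows-iterated j d λ {m} m< → grows (subst (m <_) (ℕₚ.+-comm j d) m<))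
    regroup₁ : ∀ x k D → x ℕ.* k ℕ.* D ≡ k ℕ.* (x ℕ.* D)
    regroup₁ = solve-∀
    regroup₂ : ∀ d x b e f → 2 ℕ.* d ℕ.* (x ℕ.* (b ℕ.* (e ℕ.* f))) ≡ 2 ℕ.* b ℕ.* e ℕ.* (x ℕ.* f ℕ.* d)
    regroup₂ = solve-∀
    regroup₃ : ∀ b e y d → 2 ℕ.* b ℕ.* e ℕ.* (y ℕ.* (2 ℕ.* d)) ≡ y ℕ.* e ℕ.* (4 ℕ.* d ℕ.* b)
    regroup₃ = solve-∀

  -- Strong induction, since `few-losses` looks back over the `d` preceding steps. Below `d` no
  -- window fits, so nothing is lost.
  all-grow : ∀ m → Grows m
  all-grow = <-rec Grows λ m grows → few-losses⇒grows m (case ℕₚ.≤-<-connex d m of λ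
    { (inj₁ d≤m) → subst (λ m → B m ℕ.* 2d ≤ C m ℕ.* (n ∸ m)) (ℕₚ.m+[n∸m]≡n d≤m)
                     (few-losses (m ∸ d) λ {i} i< → grows (subst (i <_) (ℕₚ.m+[n∸m]≡n d≤m) i<))
    ; (inj₂ m<d) → subst (λ x → x ℕ.* 2d ≤ C m ℕ.* (n ∸ m)) (sym (small m m<d)) z≤n })

  C>0 : ∀ m → m ≤ n → 0 < C m
  C>0 zero    _   = C₀>0
  C>0 (suc m) m<n = ℕₚ.*-cancelʳ-< 2d 0 (C (suc m))
    (ℕₚ.<-≤-trans (ℕₚ.*-mono-< (ℕₚ.*-mono-< (C>0 m (ℕₚ.<⇒≤ m<n)) (ℕₚ.m<n⇒0<n∸m m<n)) c>0) (all-grow m))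
    where
    c>0 : 0 < c
    c>0 = ℕₚ.pred-mono-≤ (ℕₚ.*-monoʳ-≤ 2 (ℕ.>-nonZero⁻¹ d))

-- Good words and the tight paths they spell.

truncate-++ : ∀ {i j} (u : Vec A i) (z : Vec A j) (i≤i+j : i ≤ i + j) → truncate i≤i+j (u Vec.++ z) ≡ u
truncate-++ []      z _           = refl
truncate-++ (x ∷ u) z (s≤s i≤i+j) = cong (x ∷_) (truncate-++ u z i≤i+j)

unique-++⁻ˡ : ∀ {i j} (u : Vec (Fin n) i) {z : Vec (Fin n) j} → Unique (u Vec.++ z) → Arrangement (_∉ z) u
unique-++⁻ˡ []      _          = [] , []
unique-++⁻ˡ (x ∷ u) (x∉ ∷ uz!) with u! , u∉ ← unique-++⁻ˡ u uz! =
  Allₚ.++ˡ⁻ u x∉ ∷ u! , All≢⇒∉ (Allₚ.++ʳ⁻ u x∉) ∷ u∉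

lookup-ext : {xs ys : Vec A m} → (∀ i → lookup xs i ≡ lookup ys i) → xs ≡ ys
lookup-ext {xs = xs} {ys} eq =
  trans (sym (tabulate∘lookup xs)) (trans (tabulate-cong eq) (tabulate∘lookup ys))

module GoodWords {d k : ℕ} (G : Digraph (suc d) n) (tournament : IsTournament k G) where

  private
    r : ℕ
    r = suc d

  -- Quantifying over the proof of `r ≤ m` makes the condition vacuous for words too short to have a
  -- window.
  Initial : Pred (Vec (Fin n) m) 0ℓ
  Initial {m} w = (r≤m : r ≤ m) → Edge G (truncate r≤m w)

  initial? : Decidable (Initial {m})
  initial? {m} w with r ℕₚ.≤? m
  ... | no r≰m  = yes λ r≤m → contradiction r≤m r≰m
  ... | yes r≤m with edge? G (truncate r≤m w)
  ...   | yes e = yes λ r≤m′ → subst (Edge G) (truncate-irrelevant r≤m r≤m′ w) e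
  ...   | no ¬e = no λ f → ¬e (f r≤m)

  Good : Pred (Vec (Fin n) m) 0ℓ
  Good []      = ⊤
  Good (v ∷ w) = (Good w × v ∉ w) × Initial (v ∷ w)

  Extends : Pred (Vec (Fin n) (suc m)) 0ℓ
  Extends (v ∷ w) = Good w × v ∉ w

  good? : Decidable (Good {m})
  good? []      = yes tt
  good? (v ∷ w) = (good? w ×-dec ¬? (v ∈? w)) ×-dec initial? (v ∷ w)

  extends? : Decidable (Extends {m})
  extends? (v ∷ w) = good? w ×-dec ¬? (v ∈? w)

  Bad : Pred (Vec (Fin n) (suc m)) 0ℓ
  Bad w = Extends w × ¬ Initial w

  bad? : Decidable (Bad {m})
  bad? w = extends? w ×-dec ¬? (initial? w)

  good⇒unique : {w : Vec (Fin n) m} → Good w → Unique w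
  good⇒unique {w = []}    _               = []
  good⇒unique {w = v ∷ w} ((g , v∉w) , _) = ∉⇒All≢ v∉w ∷ good⇒unique g

  good-++⁻ʳ : ∀ {i j} (u : Vec (Fin n) i) {z : Vec (Fin n) j} → Good (u Vec.++ z) → Good z
  good-++⁻ʳ []      g             = g
  good-++⁻ʳ (_ ∷ u) ((g , _) , _) = good-++⁻ʳ u g

  -- Here the windows overlapping the first one are forgotten: of the goodness behind the first
  -- letter only that of `z` is kept, and `u` becomes an arbitrary non-edge on letters outside `z`.
  bad-++⁻ : ∀ {j} (u : Vec (Fin n) r) {z : Vec (Fin n) j} → Bad (u Vec.++ z) →
            Good z × Arrangement (_∉ z) u × ¬ Edge G u
  bad-++⁻ (v ∷ u) {z} ((g , v∉) , ¬init) =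
    good-++⁻ʳ u g , unique-++⁻ˡ (v ∷ u) (∉⇒All≢ v∉ ∷ good⇒unique g) ,
    λ e → ¬init λ r≤ → subst (Edge G) (sym (truncate-++ (v ∷ u) z r≤)) e

  count-good : ∀ m → count good? (words (suc m)) + count bad? (words (suc m))
                     ≡ count good? (words m) ℕ.* (n ∸ m)
  count-good m = begin
    count good? (words (suc m)) + count bad? (words (suc m))
      ≡⟨ cong (_+ count bad? (words (suc m)))
           (count-cong good? (λ w → extends? w ×-dec initial? w) (words (suc m)) λ { (_ ∷ _) → mk⇔ id id }) ⟩
    count (λ w → extends? w ×-dec initial? w) (words (suc m)) + count bad? (words (suc m))
      ≡⟨ count-split extends? initial? (words (suc m)) ⟨
    count extends? (words (suc m))
      ≡⟨ ∑-cartesianProductWith _∷_ (allFin n) (words m) _ ⟩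
    ∑ (allFin n) (λ v → count (λ w → extends? (v ∷ w)) (words m))
      ≡⟨ ∑-swap (allFin n) (words m) _ ⟩
    ∑ (words m) (λ w → count (λ v → good? w ×-dec ¬? (v ∈? w)) (allFin n))
      ≡⟨ ∑-fibres good? (λ w v → ¬? (v ∈? w)) (words m) (allFin n) (n ∸ m) (λ w → count-∉ ∘ good⇒unique) ⟩
    count good? (words m) ℕ.* (n ∸ m) ∎
    where open ≡-Reasoning

  count-bad-small : ∀ m → m < d → count bad? (words (suc m)) ≡ 0
  count-bad-small m m<d = count-none bad? (words (suc m))
    λ { _ (_ , ¬init) → ¬init λ { (s≤s d≤m) → contradiction d≤m (ℕₚ.<⇒≱ m<d) } }

  -- For each good suffix `z`, `count-non-edges` is applied to the `n ∸ j` letters that `z` leaves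
  -- free.
  count-bad : ∀ j → count bad? (words (r + j)) ℕ.* r !
                    ≤ count good? (words j) ℕ.* ((r ! ∸ k) ℕ.* ((n ∸ j) P′ r))
  count-bad j = begin
    count bad? (words (r + j)) ℕ.* r !
      ≡⟨ cong (ℕ._* r !) (∑-words-++ r j _) ⟩
    ∑ (words j) (λ z → count (λ u → bad? (u Vec.++ z)) (words r)) ℕ.* r !
      ≤⟨ ℕₚ.*-monoˡ-≤ (r !) (∑-mono (words j) λ z → ∑-mono (words r) λ u →
           ♯-mono (bad? (u Vec.++ z)) (good? z ×-dec missed? z u) (bad-++⁻ u)) ⟩
    ∑ (words j) (λ z → count (λ u → good? z ×-dec missed? z u) (words r)) ℕ.* r !
      ≡⟨ ∑-fibres-* good? missed? (words j) (words r) (r !) _ missed ⟩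
    count good? (words j) ℕ.* ((r ! ∸ k) ℕ.* ((n ∸ j) P′ r)) ∎
    where
    open ℕₚ.≤-Reasoning
    missed? : (z : Vec (Fin n) j) → Decidable (λ u → Arrangement (_∉ z) u × ¬ Edge G u)
    missed? z u = arrangement? (λ v → ¬? (v ∈? z)) u ×-dec ¬? (edge? G u)
    missed : ∀ z → Good z → count (missed? z) (words r) ℕ.* r ! ≡ (r ! ∸ k) ℕ.* ((n ∸ j) P′ r)
    missed z g = trans (count-non-edges G tournament (λ v → ¬? (v ∈? z)))
                       (cong (λ s → (r ! ∸ k) ℕ.* (s P′ r)) (count-∉ (good⇒unique g)))

  -- Letters before the window are dropped until it starts the word, where goodness supplies the
  -- edge. Giving its positions as a function `pos` avoids index arithmetic in `Fin`.
  good⇒window : {w : Vec (Fin n) m} → Good w → ∀ i (u : Vec (Fin n) r) (pos : Fin r → Fin m) →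
    (∀ j → toℕ (pos j) ≡ i + toℕ j) → (∀ j → lookup u j ≡ lookup w (pos j)) → Edge G u
  good⇒window {w = []} _ i u pos _ _ with () ← pos zero
  good⇒window {w = v ∷ w} (_ , init) zero u pos pos≡ u≡ =
    subst (Edge G) (lookup-ext λ j → trans (lookup-truncate r≤m (v ∷ w) j)
                                           (trans (cong (lookup (v ∷ w)) (same j)) (sym (u≡ j))))
          (init r≤m)
    where
    -- The last position of the window has index `d` and lies in the word, so the word has at least
    -- `suc d` letters.
    r≤m : r ≤ _
    r≤m = subst (_< _) (trans (pos≡ (fromℕ d)) (toℕ-fromℕ d)) (toℕ<n (pos (fromℕ d)))
    same : ∀ j → inject≤ j r≤m ≡ pos j
    same j = toℕ-injective (trans (toℕ-inject≤ j r≤m) (sym (pos≡ j)))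
  good⇒window {w = v ∷ w} ((g , _) , _) (suc i) u pos pos≡ u≡ =
    good⇒window g i u (λ j → proj₁ (lower j))
      (λ j → ℕₚ.suc-injective (trans (cong toℕ (sym (proj₂ (lower j)))) (pos≡ j)))
      (λ j → trans (u≡ j) (cong (lookup (v ∷ w)) (proj₂ (lower j))))
    where
    predecessor : ∀ {m t} (x : Fin (suc m)) → toℕ x ≡ suc t → ∃ λ y → x ≡ suc y
    predecessor (suc y) _ = y , refl
    lower : ∀ j → ∃ λ y → pos j ≡ suc y
    lower j = predecessor (pos j) (pos≡ j)

  good⇒contains : {w : Vec (Fin n) m} → Good w → G Contains tightPath r m
  good⇒contains {w = w} g = lookup w , (λ {i} {j} → lookup-injective (good⇒unique g) i j) ,
    λ { c (i , c≡) → good⇒window g (toℕ i) _ (lookup c) c≡ (λ j → lookup-map j (lookup w) c) }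

spanning : ∀ {n d k} → .{{_ : NonZero d}} → 4 ℕ.* d ℕ.* (suc d ! ∸ k) ≤ suc d ! → Unavoidable n (suc d) k n
spanning {n} {d} {k} {{d≢0}} few G tournament =
  good⇒contains (proj₂ (count>0⇒∃ good? (words n) (C>0 n ℕₚ.≤-refl)))
  where
  open GoodWords G tournament
  open Recurrence n d (suc d ! ∸ k) (suc d !) {{d≢0}} {{suc d ℕₚ.!≢0}}
    (λ m → count good? (words m)) (λ m → count bad? (words (suc m)))
    -- `C 0` is 1, the empty word being good.
    few ℕₚ.≤-refl count-good count-bad-small count-bad

-- A tournament for every `k` up to `r !`, and the upper bound.

enumerates⇒support≡ : {w : Vec (Fin n) m} {S : Subset n} → w Enumerates (_∈ₛ S) → support w ≡ S
enumerates⇒support≡ (_ , v∈⇔) =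
  ⊆-antisym (λ {v} v∈ → to (v∈⇔ v) (to ∈-support v∈)) (λ {v} v∈ → from ∈-support (from (v∈⇔ v) v∈))

take-⊆ : ∀ k {xs : List A} {x : A} → x ∈ₗ List.take k xs → x ∈ₗ xs
take-⊆ k = Allₗ.lookup (Allₗₚ.take⁺ k (Allₗ.tabulate id))

orderings : ∀ {r} → Subset n → List (Vec (Fin n) r)
orderings S = filter (arrangement? (_∈ₛ? S)) (words _)

∈-orderings⇒arrangement : ∀ {r} {S : Subset n} {w : Vec (Fin n) r} → w ∈ₗ orderings S → Arrangement (_∈ₛ S) w
∈-orderings⇒arrangement {S = S} w∈ = proj₂ (∈-filter⁻ (arrangement? (_∈ₛ? S)) {xs = words _} w∈)

length-orderings : ∀ {r} (S : Subset n) → ∣ S ∣ ≡ r → length (orderings {r = r} S) ≡ r !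
length-orderings {n} {r} S ∣S∣≡r = begin
  length (orderings {r = r} S)               ≡⟨ length-filter≡count (arrangement? (_∈ₛ? S)) (words r) ⟩
  count (arrangement? (_∈ₛ? S)) (words r)    ≡⟨ count-arrangements (_∈ₛ? S) r ⟩
  count (_∈ₛ? S) (allFin n) P′ r             ≡⟨ cong (_P′ r) (trans (sym (∣∣≡count S)) ∣S∣≡r) ⟩
  r P′ r                                     ≡⟨ nP′n≡n! r ⟩
  r !                                        ∎
  where open ≡-Reasoning

-- A list determines its vertex set as its support, so the choices made for different sets do not
-- interfere.
firstOrderings : ∀ n r → ℕ → Digraph r n
firstOrderings n r k = record
  { Edge     = λ w → w ∈ₗ List.take k (orderings (support w))
  ; edge?    = λ w → ListDec._∈?_ (≡-dec _≟ᶠ_) w (List.take k (orderings (support w)))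
  ; distinct = λ e → proj₁ (∈-orderings⇒arrangement (take-⊆ k e))
  }

firstOrderings-isTournament : ∀ {n r k} → k ≤ r ! → IsTournament k (firstOrderings n r k)
firstOrderings-isTournament {n} {r} {k} k≤r! S ∣S∣≡r =
  subst (λ l → HasExactly l (λ w → w Enumerates (_∈ₛ S) × Edge (firstOrderings n r k) w)) length≡k
    (hasExactly-fromList (Uniqueₗ.take⁺ k (Uniqueₗ.filter⁺ (arrangement? (_∈ₛ? S)) (words-unique r)))
      λ w → mk⇔ (enum w) λ { (e , w∈) →
        subst (λ T → w ∈ₗ List.take k (orderings T)) (enumerates⇒support≡ e) w∈ })
  where
  length≡k : length (List.take k (orderings {r = r} S)) ≡ k
  length≡k = trans (length-take k (orderings S))
                   (ℕₚ.m≤n⇒m⊓n≡m (subst (k ≤_) (sym (length-orderings S ∣S∣≡r)) k≤r!))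
  enum : ∀ w → w ∈ₗ List.take k (orderings S) → w Enumerates (_∈ₛ S) × Edge (firstOrderings n r k) w
  enum w w∈ = e , subst (λ T → w ∈ₗ List.take k (orderings T)) (sym (enumerates⇒support≡ e)) w∈
    where
    e : w Enumerates (_∈ₛ S)
    e = arrangement-enumerates (_∈ₛ? S) (∈-orderings⇒arrangement (take-⊆ k w∈))
          (trans (sym (∣∣≡count S)) ∣S∣≡r)

-- In a tournament that exists, a copy of the path injects its `t` vertices into `n` vertices.
unavoidable⇒≤ : ∀ {n r k t} → k ≤ r ! → Unavoidable n r k t → t ≤ n
unavoidable⇒≤ {n} {r} {k} k≤r! unavoidable
  with _ , inj , _ ← unavoidable (firstOrderings n r k) (firstOrderings-isTournament k≤r!) = injective⇒≤ inj

-- From the rational hypothesis to natural numbers.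

toℚᵘ-/ : ∀ i m → ℚ.toℚᵘ (i / suc m) ℚᵘ.≃ ℚᵘ.mkℚᵘ i m
toℚᵘ-/ i m = ℚₚ.toℚᵘ-fromℚᵘ (ℚᵘ.mkℚᵘ i m)

1-1/[1+m] : ∀ m → ℚᵘ.1ℚᵘ ℚᵘ.- ℚᵘ.mkℚᵘ (+ 1) m ℚᵘ.≃ ℚᵘ.mkℚᵘ (+ m) m
1-1/[1+m] m = ℚᵘ.*≡* (trans
  (cong (ℤ._* + suc m) (cong (ℤ._+ ℤ.-1ℤ) (ℤₚ.*-identityˡ (+ suc m))))
  (cong (λ x → + m ℤ.* + x) (sym (ℕₚ.*-identityˡ (suc m)))))

-- In unnormalised rationals the hypothesis is a cross-multiplied inequality, `m` times `D` below
-- `suc m` times `k`; subtracting from `suc m` times `D` leaves at most `D`.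
[1+m]*[D∸k]≤D : ∀ m k D → + k / 1 > (1ℚ - + 1 / suc m) * (+ D / 1) → suc m ℕ.* (D ∸ k) ≤ D
[1+m]*[D∸k]≤D m k D k> = begin
  suc m ℕ.* (D ∸ k)          ≡⟨ ℕₚ.*-distribˡ-∸ (suc m) D k ⟩
  suc m ℕ.* D ∸ suc m ℕ.* k  ≤⟨ ℕₚ.∸-monoʳ-≤ (suc m ℕ.* D) (ℕₚ.<⇒≤ mD<[1+m]k) ⟩
  D + m ℕ.* D ∸ m ℕ.* D      ≡⟨ ℕₚ.m+n∸n≡m D (m ℕ.* D) ⟩
  D                          ∎
  where
  open ℕₚ.≤-Reasoning
  1/[1+m] : ℚ.ℚ
  1/[1+m] = + 1 / suc m
  toℚᵘ-1-1/[1+m] : ℚ.toℚᵘ (1ℚ - 1/[1+m]) ℚᵘ.≃ ℚᵘ.mkℚᵘ (+ m) m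
  toℚᵘ-1-1/[1+m] = ℚᵘₚ.≃-trans (ℚₚ.toℚᵘ-homo-+ 1ℚ (ℚ.- 1/[1+m])) (ℚᵘₚ.≃-trans
    (ℚᵘₚ.+-congʳ ℚᵘ.1ℚᵘ (ℚᵘₚ.≃-trans (ℚₚ.toℚᵘ-homo‿- 1/[1+m]) (ℚᵘₚ.-‿cong (toℚᵘ-/ (+ 1) m))))
    (1-1/[1+m] m))
  ᵘ< : ℚᵘ.mkℚᵘ (+ m) m ℚᵘ.* ℚᵘ.mkℚᵘ (+ D) 0 ℚᵘ.< ℚᵘ.mkℚᵘ (+ k) 0
  ᵘ< = ℚᵘₚ.<-respˡ-≃
    (ℚᵘₚ.≃-trans (ℚₚ.toℚᵘ-homo-* (1ℚ - 1/[1+m]) (+ D / 1)) (ℚᵘₚ.*-cong toℚᵘ-1-1/[1+m] (toℚᵘ-/ (+ D) 0)))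
    (ℚᵘₚ.<-respʳ-≃ (toℚᵘ-/ (+ k) 0) (ℚₚ.toℚᵘ-mono-< k>))
  mD<[1+m]k : m ℕ.* D < suc m ℕ.* k
  mD<[1+m]k = ℤₚ.drop‿+<+ (subst₂ ℤ._<_
    (trans (ℤₚ.*-identityʳ _) (sym (ℤₚ.pos-* m D)))
    (trans (sym (ℤₚ.pos-* k _))
           (cong +_ (trans (ℕₚ.*-comm k _) (cong (ℕ._* k) (ℕₚ.*-identityʳ (suc m))))))
    (ℚᵘₚ.drop-*<* ᵘ<))

theorem21 : (n r k : ℕ) → r ℕ.≤ n → (2≤r : 2 ℕ.≤ r) → k ℕ.≤ r ! →
    (+ k / 1) > (1ℚ - _/_ (+ 1) (4 ℕ.* (r ∸ 1)) {{4[r-1]-nonZero 2≤r}}) * (+ (r !) / 1) →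
    f[ n , r , k ]≡ n
theorem21 n (suc (suc d)) k _ (s≤s (s≤s _)) k≤r! k> =
  -- With r = d + 2, the denominator 4(r - 1) is the successor of the chosen `m`, and `spanning`
  -- runs with `suc d` as its `d`.
  spanning ([1+m]*[D∸k]≤D (ℕ.pred (4 ℕ.* suc d)) k (suc (suc d) !) k>) , λ t → unavoidable⇒≤ k≤r!
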